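{- Let $U_{r,n}$ be the full simplicial complex of dimension $r$ on a set $X=\{f_1,\dots,f_n\}$ of size $n$, i.e. the family of all subsets of $X$ of size at most $r$. Then $\dim_{\mathbb{E}}(U_{r,n})\geq\min(2r,n-1)$.
   Context: A realization of a family $\mathcal{S}\subseteq 2^U$ ($U$ finite) in $\mathbb{R}^m$ consists of oriented affine hyperplanes $(H_e)_{e\in U}$ of $\mathbb{R}^m$, where $H_e=\{x:a_e\cdot x=b_e\}$ with $a_e\neq 0$, $H_e^+=\{x:a_e\cdot x>b_e\}$, $H_e^-=\{x:a_e\cdot x<b_e\}$, and a relatively open convex set $K\subseteq\mathbb{R}^m$ such that $Y\subseteq U$ belongs to $\mathcal{S}$ if and only if there is $x\in K$ with $x\in H_e^+$ for all $e\in Y$ and $x\in H_e^-$ for all $e\in U\setminus Y$. The Euclidean dimension $\dim_{\mathbb{E}}(\mathcal{S})$ is the smallest $m$ such that $\mathcal{S}$ has a realization in $\mathbb{R}^m$. Here the universe is $U=X$. -}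

module Defs where

open import Data.Fin.Base using (Fin)
open import Data.Fin.Subset using (Subset; _∈_; _∉_; ∣_∣)
open import Data.Nat.Base as ℕ using (ℕ)
import Data.Nat.Properties as ℕ
open import Data.Product.Base using (∃-syntax; Σ-syntax; _×_; _,_)
open import Data.Rational.Base as ℚ using (ℚ; 0ℚ; 1ℚ)
import Data.Rational.Properties as ℚ
open import Data.Rational.Solver using (module +-*-Solver)
open import Data.Vec.Functional using (Vector; foldr)
open import Function.Bundles using (_⇔_)
open import Level using (Level; 0ℓ; suc)
open import Relation.Binary.PropositionalEquality
open import Relation.Nullary.Negation.Core using (¬_)
open import Relation.Unary using (Pred)

module RationalBounds where

  shrink : ∀ {B ε} → 0ℚ ℚ.< B → 0ℚ ℚ.< ε → ∃[ δ ] 0ℚ ℚ.< δ × B ℚ.* δ ≡ ε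
  shrink {B} {ε} 0<B 0<ε = ε ℚ.* 1/B , 0<δ , Bδ≡ε
    where
    instance
      posB : ℚ.Positive B
      posB = ℚ.positive 0<B
      posε : ℚ.Positive ε
      posε = ℚ.positive 0<ε
      nzB : ℚ.NonZero B
      nzB = ℚ.pos⇒nonZero B
    1/B : ℚ
    1/B = ℚ.1/ B
    instance
      pos1/B : ℚ.Positive 1/B
      pos1/B = ℚ.1/pos⇒pos B
    0<δ : 0ℚ ℚ.< ε ℚ.* 1/B
    0<δ = ℚ.positive⁻¹ _ {{ℚ.pos*pos⇒pos ε 1/B}}
    Bδ≡ε : B ℚ.* (ε ℚ.* 1/B) ≡ ε
    Bδ≡ε = begin
      B ℚ.* (ε ℚ.* 1/B)  ≡⟨ solve 3 (λ b e i → b :* (e :* i) := e :* (b :* i)) refl B ε 1/B ⟩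
      ε ℚ.* (B ℚ.* 1/B)  ≡⟨ cong (ε ℚ.*_) (ℚ.*-inverseʳ B) ⟩
      ε ℚ.* 1ℚ           ≡⟨ ℚ.*-identityʳ ε ⟩
      ε                  ∎
      where open ≡-Reasoning
            open +-*-Solver

  halve : ∀ {ε} → 0ℚ ℚ.< ε → ∃[ δ ] 0ℚ ℚ.< δ × δ ℚ.+ δ ≡ ε
  halve {ε} 0<ε =
    let δ , 0<δ , 2δ≡ε = shrink {1ℚ ℚ.+ 1ℚ} (ℚ.positive⁻¹ _) 0<ε
    in δ , 0<δ , trans (sym (double δ)) 2δ≡ε
    where
    double : ∀ δ → (1ℚ ℚ.+ 1ℚ) ℚ.* δ ≡ δ ℚ.+ δ
    double δ = trans (ℚ.*-distribʳ-+ δ 1ℚ 1ℚ) (cong₂ ℚ._+_ (ℚ.*-identityˡ δ) (ℚ.*-identityˡ δ))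

  ∣*∣-bound : ∀ {B δ} a d → 0ℚ ℚ.< B →
              ℚ.∣ a ∣ ℚ.≤ B → ℚ.∣ d ∣ ℚ.< δ → ℚ.∣ a ℚ.* d ∣ ℚ.< B ℚ.* δ
  ∣*∣-bound {B} {δ} a d 0<B a≤B d<δ = begin-strict
    ℚ.∣ a ℚ.* d ∣          ≡⟨ ℚ.∣p*q∣≡∣p∣*∣q∣ a d ⟩
    ℚ.∣ a ∣ ℚ.* ℚ.∣ d ∣    ≤⟨ ℚ.*-monoʳ-≤-nonNeg ℚ.∣ d ∣ {{ℚ.nonNegative (ℚ.0≤∣p∣ d)}} a≤B ⟩
    B ℚ.* ℚ.∣ d ∣          <⟨ ℚ.*-monoʳ-<-pos B {{ℚ.positive 0<B}} d<δ ⟩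
    B ℚ.* δ                ∎
    where open ℚ.≤-Reasoning

open RationalBounds

-- Cantor's construction: Cauchy sequences of rationals, with equality _≈_
-- "the difference is a null sequence".
module Real where

  IsCauchy : (ℕ → ℚ) → Set
  IsCauchy s = ∀ ε → 0ℚ ℚ.< ε →
    ∃[ N ] (∀ i j → N ℕ.≤ i → N ℕ.≤ j → ℚ.∣ s i ℚ.- s j ∣ ℚ.< ε)

  record ℝ : Set where
    constructor cauchy
    field
      seq      : ℕ → ℚ
      isCauchy : IsCauchy seq

  open ℝ public

  infix  4 _≈_ _<_ _≤_ _>_
  infixl 6 _+_ _-_
  infixl 7 _*_
  infix  8 -_

  _≈_ : ℝ → ℝ → Set
  x ≈ y = ∀ ε → 0ℚ ℚ.< ε →
    ∃[ N ] (∀ i → N ℕ.≤ i → ℚ.∣ seq x i ℚ.- seq y i ∣ ℚ.< ε)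

  -- A termwise strict inequality would not be invariant under _≈_: the gap has
  -- to be eventually bounded away from 0.
  _<_ : ℝ → ℝ → Set
  x < y = ∃[ ε ] 0ℚ ℚ.< ε × ∃[ N ] (∀ i → N ℕ.≤ i → seq x i ℚ.+ ε ℚ.< seq y i)

  _>_ : ℝ → ℝ → Set
  x > y = y < x

  _≤_ : ℝ → ℝ → Set
  x ≤ y = ¬ (y < x)

  private
    variable
      s t : ℕ → ℚ

  -- Abstract because otherwise the typechecker normalizes these proofs inside
  -- every real expression.
  abstract

    const-isCauchy : ∀ q → IsCauchy (λ _ → q)
    const-isCauchy q ε 0<ε = 0 , λ _ _ _ _ →
      subst (λ z → ℚ.∣ z ∣ ℚ.< ε) (sym (ℚ.+-inverseʳ q)) 0<ε

    neg-isCauchy : IsCauchy s → IsCauchy (λ i → ℚ.- s i)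
    neg-isCauchy {s} hs ε 0<ε =
      let N , h = hs ε 0<ε in
      N , λ i j N≤i N≤j → subst (ℚ._< ε) (lemma (s i) (s j)) (h i j N≤i N≤j)
      where
      lemma : ∀ p q → ℚ.∣ p ℚ.- q ∣ ≡ ℚ.∣ (ℚ.- p) ℚ.- (ℚ.- q) ∣
      lemma p q = trans (sym (ℚ.∣-p∣≡∣p∣ (p ℚ.- q))) (cong ℚ.∣_∣ (ℚ.neg-distrib-+ p (ℚ.- q)))

    +-isCauchy : IsCauchy s → IsCauchy t → IsCauchy (λ i → s i ℚ.+ t i)
    +-isCauchy {s} {t} hs ht ε 0<ε =
      let δ , 0<δ , δ+δ≡ε = halve 0<ε
          M , hM = hs δ 0<δ
          N , hN = ht δ 0<δ
      in M ℕ.⊔ N , λ i j ≤i ≤j → begin-strict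
        ℚ.∣ (s i ℚ.+ t i) ℚ.- (s j ℚ.+ t j) ∣
          ≡⟨ cong ℚ.∣_∣ (regroup (s i) (t i) (s j) (t j)) ⟩
        ℚ.∣ (s i ℚ.- s j) ℚ.+ (t i ℚ.- t j) ∣
          ≤⟨ ℚ.∣p+q∣≤∣p∣+∣q∣ (s i ℚ.- s j) (t i ℚ.- t j) ⟩
        ℚ.∣ s i ℚ.- s j ∣ ℚ.+ ℚ.∣ t i ℚ.- t j ∣
          <⟨ ℚ.+-mono-< (hM i j (ℕ.m⊔n≤o⇒m≤o M N ≤i) (ℕ.m⊔n≤o⇒m≤o M N ≤j))
                        (hN i j (ℕ.m⊔n≤o⇒n≤o M N ≤i) (ℕ.m⊔n≤o⇒n≤o M N ≤j)) ⟩
        δ ℚ.+ δ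
          ≡⟨ δ+δ≡ε ⟩
        ε ∎
      where
      open ℚ.≤-Reasoning
      open +-*-Solver
      regroup : ∀ a b c d → (a ℚ.+ b) ℚ.- (c ℚ.+ d) ≡ (a ℚ.- c) ℚ.+ (b ℚ.- d)
      regroup = solve 4 (λ a b c d → (a :+ b) :- (c :+ d) := (a :- c) :+ (b :- d)) refl

    eventuallyBounded : IsCauchy s →
      ∃[ B ] 0ℚ ℚ.< B × ∃[ N ] (∀ i → N ℕ.≤ i → ℚ.∣ s i ∣ ℚ.≤ B)
    eventuallyBounded {s} hs =
      let 0<1   = ℚ.positive⁻¹ 1ℚ
          N , h = hs 1ℚ 0<1
      in 1ℚ ℚ.+ ℚ.∣ s N ∣ , ℚ.+-mono-<-≤ 0<1 (ℚ.0≤∣p∣ (s N)) , N , λ i N≤i → begin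
        ℚ.∣ s i ∣
          ≡⟨ cong ℚ.∣_∣ (split (s i) (s N)) ⟩
        ℚ.∣ (s i ℚ.- s N) ℚ.+ s N ∣
          ≤⟨ ℚ.∣p+q∣≤∣p∣+∣q∣ (s i ℚ.- s N) (s N) ⟩
        ℚ.∣ s i ℚ.- s N ∣ ℚ.+ ℚ.∣ s N ∣
          ≤⟨ ℚ.+-monoˡ-≤ ℚ.∣ s N ∣ (ℚ.<⇒≤ (h i N N≤i ℕ.≤-refl)) ⟩
        1ℚ ℚ.+ ℚ.∣ s N ∣ ∎
      where
      open ℚ.≤-Reasoning
      open +-*-Solver
      split : ∀ a b → a ≡ (a ℚ.- b) ℚ.+ b
      split = solve 2 (λ a b → a := (a :- b) :+ b) refl

    *-isCauchy : IsCauchy s → IsCauchy t → IsCauchy (λ i → s i ℚ.* t i)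
    *-isCauchy {s} {t} hs ht ε 0<ε =
      let δ , 0<δ , δ+δ≡ε = halve 0<ε
          A , 0<A , K , hK = eventuallyBounded hs
          B , 0<B , L , hL = eventuallyBounded ht
          α , 0<α , Bα≡δ = shrink 0<B 0<δ
          β , 0<β , Aβ≡δ = shrink 0<A 0<δ
          M , hM = hs α 0<α
          N , hN = ht β 0<β
      in (K ℕ.⊔ L) ℕ.⊔ (M ℕ.⊔ N) , λ i j ≤i ≤j →
        let K⊔L≤i = ℕ.m⊔n≤o⇒m≤o (K ℕ.⊔ L) (M ℕ.⊔ N) ≤i
            K⊔L≤j = ℕ.m⊔n≤o⇒m≤o (K ℕ.⊔ L) (M ℕ.⊔ N) ≤j
            M⊔N≤i = ℕ.m⊔n≤o⇒n≤o (K ℕ.⊔ L) (M ℕ.⊔ N) ≤i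
            M⊔N≤j = ℕ.m⊔n≤o⇒n≤o (K ℕ.⊔ L) (M ℕ.⊔ N) ≤j
        in begin-strict
        ℚ.∣ s i ℚ.* t i ℚ.- s j ℚ.* t j ∣
          ≡⟨ cong ℚ.∣_∣ (regroup (s i) (t i) (s j) (t j)) ⟩
        ℚ.∣ s i ℚ.* (t i ℚ.- t j) ℚ.+ t j ℚ.* (s i ℚ.- s j) ∣
          ≤⟨ ℚ.∣p+q∣≤∣p∣+∣q∣ (s i ℚ.* (t i ℚ.- t j)) (t j ℚ.* (s i ℚ.- s j)) ⟩
        ℚ.∣ s i ℚ.* (t i ℚ.- t j) ∣ ℚ.+ ℚ.∣ t j ℚ.* (s i ℚ.- s j) ∣
          <⟨ ℚ.+-mono-<
               (∣*∣-bound (s i) (t i ℚ.- t j) 0<A (hK i (ℕ.m⊔n≤o⇒m≤o K L K⊔L≤i))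
                 (hN i j (ℕ.m⊔n≤o⇒n≤o M N M⊔N≤i) (ℕ.m⊔n≤o⇒n≤o M N M⊔N≤j)))
               (∣*∣-bound (t j) (s i ℚ.- s j) 0<B (hL j (ℕ.m⊔n≤o⇒n≤o K L K⊔L≤j))
                 (hM i j (ℕ.m⊔n≤o⇒m≤o M N M⊔N≤i) (ℕ.m⊔n≤o⇒m≤o M N M⊔N≤j))) ⟩
        A ℚ.* β ℚ.+ B ℚ.* α
          ≡⟨ cong₂ ℚ._+_ Aβ≡δ Bα≡δ ⟩
        δ ℚ.+ δ
          ≡⟨ δ+δ≡ε ⟩
        ε ∎
      where
      open ℚ.≤-Reasoning
      open +-*-Solver
      regroup : ∀ a b c d → a ℚ.* b ℚ.- c ℚ.* d ≡ a ℚ.* (b ℚ.- d) ℚ.+ d ℚ.* (a ℚ.- c)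
      regroup = solve 4 (λ a b c d → a :* b :- c :* d := a :* (b :- d) :+ d :* (a :- c)) refl

  fromℚ : ℚ → ℝ
  fromℚ q = cauchy (λ _ → q) (const-isCauchy q)

  0ℝ 1ℝ : ℝ
  0ℝ = fromℚ 0ℚ
  1ℝ = fromℚ 1ℚ

  -_ : ℝ → ℝ
  - x = cauchy (λ i → ℚ.- seq x i) (neg-isCauchy {seq x} (isCauchy x))

  _+_ : ℝ → ℝ → ℝ
  x + y = cauchy (λ i → seq x i ℚ.+ seq y i) (+-isCauchy {seq x} {seq y} (isCauchy x) (isCauchy y))

  _-_ : ℝ → ℝ → ℝ
  x - y = x + (- y)

  _*_ : ℝ → ℝ → ℝ
  x * y = cauchy (λ i → seq x i ℚ.* seq y i) (*-isCauchy {seq x} {seq y} (isCauchy x) (isCauchy y))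

open Real

ℝ^_ : ℕ → Set
ℝ^ m = Vector ℝ m

infix 9 ℝ^_

sum : ∀ {k} → Vector ℝ k → ℝ
sum = foldr _+_ 0ℝ

infix 4 _≈ᵛ_
infixl 7 _·_

_≈ᵛ_ : ∀ {m} → ℝ^ m → ℝ^ m → Set
x ≈ᵛ y = ∀ i → x i ≈ y i

_·_ : ∀ {m} → ℝ^ m → ℝ^ m → ℝ
x · y = sum (λ i → x i * y i)

0ᵛ : ∀ {m} → ℝ^ m
0ᵛ _ = 0ℝ

dist² : ∀ {m} → ℝ^ m → ℝ^ m → ℝ
dist² x y = (λ i → x i - y i) · (λ i → x i - y i)

module _ {ℓ : Level} {m : ℕ} (K : Pred (ℝ^ m) ℓ) where

  -- ℝ is a setoid, so a subset of ℝ^m is a predicate invariant under _≈ᵛ_.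
  Extensional : Set ℓ
  Extensional = ∀ {x y} → x ≈ᵛ y → K x → K y

  Convex : Set ℓ
  Convex = ∀ {x y} → K x → K y → ∀ t → 0ℝ ≤ t → t ≤ 1ℝ →
    K (λ i → t * x i + (1ℝ - t) * y i)

  AffineHull : Pred (ℝ^ m) ℓ
  AffineHull y = Σ[ k ∈ ℕ ] Σ[ p ∈ Vector (ℝ^ m) k ] Σ[ c ∈ Vector ℝ k ]
    (∀ j → K (p j)) × sum c ≈ 1ℝ × y ≈ᵛ (λ i → sum (λ j → c j * p j i))

  -- The Euclidean ball of radius ε is written with squares to avoid roots.
  RelativelyOpen : Set ℓ
  RelativelyOpen = ∀ {x} → K x →
    ∃[ ε ] ε > 0ℝ × (∀ y → AffineHull y → dist² x y < ε * ε → K y)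

Family : ℕ → Set₁
Family n = Pred (Subset n) 0ℓ

record OrientedHyperplane (m : ℕ) : Set where
  field
    a   : ℝ^ m
    b   : ℝ
    a≉0 : ¬ (a ≈ᵛ 0ᵛ)

  H⁺ H⁻ : Pred (ℝ^ m) 0ℓ
  H⁺ x = a · x > b
  H⁻ x = a · x < b

record Realization (ℓ : Level) {n : ℕ} (𝒮 : Family n) (m : ℕ) : Set (suc ℓ) where
  open OrientedHyperplane
  field
    H              : Fin n → OrientedHyperplane m
    K              : Pred (ℝ^ m) ℓ
    extensional    : Extensional K
    convex         : Convex K
    relativelyOpen : RelativelyOpen K
    realizes       : ∀ Y → 𝒮 Y ⇔
      (Σ[ x ∈ ℝ^ m ] K x × (∀ e → e ∈ Y → H⁺ (H e) x) × (∀ e → e ∉ Y → H⁻ (H e) x))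

-- `𝒮 hasDim𝔼[ ℓ ] d` says that the Euclidean dimension is d, and
-- `k ≤dim𝔼[ ℓ ] 𝒮` that it is at least k (min ∅ being ∞); the level ℓ is that
-- of the convex sets K.  The minimum is not a function of 𝒮 because
-- realizability in ℝ^m is not constructively decidable.
infix 4 _≤dim𝔼[_]_ _hasDim𝔼[_]_

_≤dim𝔼[_]_ : ∀ {n} → ℕ → (ℓ : Level) → Family n → Set (suc ℓ)
k ≤dim𝔼[ ℓ ] 𝒮 = ∀ m → Realization ℓ 𝒮 m → k ℕ.≤ m

_hasDim𝔼[_]_ : ∀ {n} → Family n → (ℓ : Level) → ℕ → Set (suc ℓ)
𝒮 hasDim𝔼[ ℓ ] d = Realization ℓ 𝒮 d × (d ≤dim𝔼[ ℓ ] 𝒮)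

≤dim𝔼⇒≤ : ∀ {n ℓ k d} {𝒮 : Family n} → 𝒮 hasDim𝔼[ ℓ ] d → k ≤dim𝔼[ ℓ ] 𝒮 → k ℕ.≤ d
≤dim𝔼⇒≤ {d = d} (R , _) k≤ = k≤ d R

≤⇒≤dim𝔼 : ∀ {n ℓ k d} {𝒮 : Family n} → 𝒮 hasDim𝔼[ ℓ ] d → k ℕ.≤ d → k ≤dim𝔼[ ℓ ] 𝒮
≤⇒≤dim𝔼 (_ , least) k≤d m R = ℕ.≤-trans k≤d (least m R)

U : ∀ r n → Family n
U r n Y = ∣ Y ∣ ℕ.≤ r

{-# OPTIONS --safe #-}
-- Among the affine functionals a_e · x - b_e on ℝ^m, any m + 2 satisfy a
-- nontrivial linear relation ∑ c_e (a_e · x - b_e) = 0.  Neither {e | c_e > 0}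
-- nor {e | c_e < 0} can then be the positive side of a point, so if
-- m + 2 ≤ n both have more than r elements, whence 2r + 2 ≤ m + 2.
-- Strict inequalities between Cauchy reals hold between their approximations
-- from some index on, and only finitely many are involved, so the argument can
-- be run over ℚ at one large index, where signs are decidable.
module Submission where

open import Defs
open import Data.Fin.Base as Fin using (Fin; zero; suc; _↑ˡ_; punchIn)
import Data.Fin.Properties as Fin
open import Data.Fin.Subset as Subset using (Subset; inside; outside; _∈_; _∉_; ∣_∣; ∁)
import Data.Fin.Subset.Properties as Subset
open import Data.Nat.Base using (ℕ; _*_; _∸_; _⊓_)
import Data.Nat.Base as ℕ
import Data.Nat.Properties as ℕ
open import Data.Product.Base using (∃-syntax; _×_; _,_; proj₁; proj₂)
open import Data.Rational.Base as ℚ using (ℚ; 0ℚ; 1ℚ)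
import Data.Rational.Properties as ℚ
open import Data.Rational.Solver using (module +-*-Solver)
open import Data.Vec.Base as Vec using ([]; _∷_)
import Data.Vec.Properties as Vec
open import Data.Vec.Functional as Vector using (Vector)
open import Function.Base using (_∘_)
open import Function.Bundles using (Equivalence)
open import Level using (Level)
open import Relation.Binary.Definitions using (tri<; tri≈; tri>)
open import Relation.Binary.PropositionalEquality
open import Relation.Nullary.Decidable using (does; yes; no; ¬?; dec-true; dec-false; decidable-stable)
open import Relation.Nullary.Negation.Core using (¬_; contradiction)
open import Relation.Unary using (Pred)

open import Algebra.Bundles using (CommutativeRing)
open import Algebra.Properties.Semiring.Sum (CommutativeRing.semiring ℚ.+-*-commutativeRing)
  using (sum-cong-≗; sum-replicate-zero; ∑-distrib-+; ∑-comm; *-distribˡ-sum; *-distribʳ-sum)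
  renaming (sum to sumℚ)
open +-*-Solver using (solve; _:+_; _:*_; _:-_; :-_; _:=_; con)

-- Finite sums and products over the rationals.

infixl 7 _·ℚ_

_·ℚ_ : ∀ {k} → Vector ℚ k → Vector ℚ k → ℚ
x ·ℚ y = sumℚ (λ j → x j ℚ.* y j)

private
  variable
    k m n r : ℕ
    ℓ : Level

sum-zero : {f : Vector ℚ n} → (∀ e → f e ≡ 0ℚ) → sumℚ f ≡ 0ℚ
sum-zero {n} f≡0 = trans (sum-cong-≗ f≡0) (sum-replicate-zero n)

sum-nonNeg : (f : Vector ℚ n) → (∀ e → 0ℚ ℚ.≤ f e) → 0ℚ ℚ.≤ sumℚ f
sum-nonNeg {ℕ.zero}  f 0≤f = ℚ.≤-refl
sum-nonNeg {ℕ.suc n} f 0≤f = ℚ.+-mono-≤ (0≤f zero) (sum-nonNeg (f ∘ suc) (0≤f ∘ suc))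

sum-pos : (f : Vector ℚ n) → (∀ e → 0ℚ ℚ.≤ f e) → ∀ e → 0ℚ ℚ.< f e → 0ℚ ℚ.< sumℚ f
sum-pos f 0≤f zero    0<fe = ℚ.+-mono-<-≤ 0<fe (sum-nonNeg (f ∘ suc) (0≤f ∘ suc))
sum-pos f 0≤f (suc e) 0<fe = ℚ.+-mono-≤-< (0≤f zero) (sum-pos (f ∘ suc) (0≤f ∘ suc) e 0<fe)

*-≢0 : ∀ {p q} → p ≢ 0ℚ → q ≢ 0ℚ → p ℚ.* q ≢ 0ℚ
*-≢0 {p} {q} p≢0 q≢0 pq≡0 = q≢0 (begin
  q                      ≡⟨ ℚ.*-identityˡ q ⟨
  1ℚ ℚ.* q               ≡⟨ cong (ℚ._* q) (ℚ.*-inverseˡ p) ⟨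
  ℚ.1/ p ℚ.* p ℚ.* q     ≡⟨ ℚ.*-assoc (ℚ.1/ p) p q ⟩
  ℚ.1/ p ℚ.* (p ℚ.* q)   ≡⟨ cong (ℚ.1/ p ℚ.*_) pq≡0 ⟩
  ℚ.1/ p ℚ.* 0ℚ          ≡⟨ ℚ.*-zeroʳ (ℚ.1/ p) ⟩
  0ℚ                     ∎)
  where
  open ≡-Reasoning
  instance
    nz : ℚ.NonZero p
    nz = ℚ.≢-nonZero p≢0

-- Linear relations between rational vectors.

NonTrivial : Pred (Vector ℚ n) _
NonTrivial c = ∃[ e ] c e ≢ 0ℚ

Relation : Vector (Vector ℚ k) n → Pred (Vector ℚ n) _
Relation v c = ∀ j → sumℚ (λ e → c e ℚ.* v e j) ≡ 0ℚ

-- Gaussian elimination on the first vector. If it is zero, it alone gives a relation. Otherwise one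
-- of its nonzero coordinates serves as pivot: it is cleared from the other vectors and dropped, and
-- a relation between the shortened vectors lifts to `v`.
dependent : (v : Vector (Vector ℚ k) (ℕ.suc k)) → ∃[ c ] NonTrivial c × Relation v c
dependent {ℕ.zero}  v = (λ _ → 1ℚ) , (zero , λ ()) , λ ()
dependent {ℕ.suc k} v with Fin.any? (λ i → ¬? (v zero i ℚ.≟ 0ℚ))
... | no v₀≡0 = c , (zero , λ ()) , relation
  where
  c : Vector ℚ (ℕ.suc (ℕ.suc k))
  c = 1ℚ Vector.∷ Vector.replicate _ 0ℚ
  relation : Relation v c
  relation j = cong₂ ℚ._+_
    (trans (ℚ.*-identityˡ _) (decidable-stable (v zero j ℚ.≟ 0ℚ) (λ v₀j≢0 → v₀≡0 (j , v₀j≢0))))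
    (sum-zero (λ e → ℚ.*-zeroˡ (v (suc e) j)))
... | yes (i , p≢0) = eliminated (dependent w)
  where
  p : ℚ
  p = v zero i
  -- Cross-multiplying with the pivot avoids division; at coordinate `i` the two products cancel.
  elim : Fin (ℕ.suc k) → Fin (ℕ.suc k) → ℚ
  elim e j = p ℚ.* v (suc e) j ℚ.- v (suc e) i ℚ.* v zero j
  w : Vector (Vector ℚ k) (ℕ.suc k)
  w e = elim e ∘ punchIn i
  eliminated : ∃[ c ] NonTrivial c × Relation w c → ∃[ c ] NonTrivial c × Relation v c
  eliminated (c , (e , ce≢0) , c-rel) = c′ , (suc e , *-≢0 p≢0 ce≢0) , relation
    where
    -- Expanding `elim` in the relation for `w` leaves the coefficient `p * c e` on `v (suc e)` and
    -- collects all multiples of `v zero` into `c₀`.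
    c₀ : ℚ
    c₀ = sumℚ (λ e → c e ℚ.* (ℚ.- v (suc e) i))
    c′ : Vector ℚ (ℕ.suc (ℕ.suc k))
    c′ = c₀ Vector.∷ λ e → p ℚ.* c e
    expand : ∀ j → sumℚ (λ e → c′ e ℚ.* v e j) ≡ sumℚ (λ e → c e ℚ.* elim e j)
    expand j = begin
      c₀ ℚ.* z ℚ.+ sumℚ g
        ≡⟨ cong (ℚ._+ sumℚ g) (*-distribʳ-sum z f) ⟩
      sumℚ (λ e → f e ℚ.* z) ℚ.+ sumℚ g
        ≡⟨ ∑-distrib-+ (λ e → f e ℚ.* z) g ⟨
      sumℚ (λ e → f e ℚ.* z ℚ.+ g e)
        ≡⟨ sum-cong-≗ (λ e → regroup (c e) (v (suc e) i) z p (v (suc e) j)) ⟩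
      sumℚ (λ e → c e ℚ.* elim e j) ∎
      where
      open ≡-Reasoning
      z : ℚ
      z = v zero j
      f g : Vector ℚ (ℕ.suc k)
      f e = c e ℚ.* (ℚ.- v (suc e) i)
      g e = p ℚ.* c e ℚ.* v (suc e) j
      regroup : ∀ c u z p x → c ℚ.* (ℚ.- u) ℚ.* z ℚ.+ p ℚ.* c ℚ.* x ≡ c ℚ.* (p ℚ.* x ℚ.- u ℚ.* z)
      regroup = solve 5 (λ c u z p x →
        c :* (:- u) :* z :+ p :* c :* x := c :* (p :* x :- u :* z)) refl
    elim-zero : ∀ e → c e ℚ.* elim e i ≡ 0ℚ
    elim-zero e = solve 3 (λ c p u → c :* (p :* u :- u :* p) := con 0ℚ) refl (c e) p (v (suc e) i)
    relation : Relation v c′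
    relation j with i Fin.≟ j
    -- `w` omits coordinate `i`, so `c-rel` says nothing here; the sum vanishes term by term
    -- instead.
    ... | yes refl = trans (expand i) (sum-zero elim-zero)
    ... | no i≢j   = trans (expand j)
      (subst (λ j → sumℚ (λ e → c e ℚ.* elim e j) ≡ 0ℚ) (Fin.punchIn-punchOut i≢j)
        (c-rel (Fin.punchOut i≢j)))

-- Exchanging the two summations turns the left side into a combination of the column sums, each of
-- which is zero.
relation-· : (v : Vector (Vector ℚ k) n) (c : Vector ℚ n) → Relation v c →
             ∀ y → sumℚ (λ e → c e ℚ.* (v e ·ℚ y)) ≡ 0ℚ
relation-· v c rel y = begin
  sumℚ (λ e → c e ℚ.* (v e ·ℚ y))
    ≡⟨ sum-cong-≗ (λ e → *-distribˡ-sum (c e) (λ j → v e j ℚ.* y j)) ⟩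
  sumℚ (λ e → sumℚ (λ j → c e ℚ.* (v e j ℚ.* y j)))
    ≡⟨ ∑-comm (λ e j → c e ℚ.* (v e j ℚ.* y j)) ⟩
  sumℚ (λ j → sumℚ (λ e → c e ℚ.* (v e j ℚ.* y j)))
    ≡⟨ sum-zero column ⟩
  0ℚ ∎
  where
  open ≡-Reasoning
  column : ∀ j → sumℚ (λ e → c e ℚ.* (v e j ℚ.* y j)) ≡ 0ℚ
  column j = begin
    sumℚ (λ e → c e ℚ.* (v e j ℚ.* y j))
      ≡⟨ sum-cong-≗ (λ e → ℚ.*-assoc (c e) (v e j) (y j)) ⟨
    sumℚ (λ e → c e ℚ.* v e j ℚ.* y j)
      ≡⟨ *-distribʳ-sum (y j) (λ e → c e ℚ.* v e j) ⟨
    sumℚ (λ e → c e ℚ.* v e j) ℚ.* y j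
      ≡⟨ cong (ℚ._* y j) (rel j) ⟩
    0ℚ ℚ.* y j
      ≡⟨ ℚ.*-zeroˡ (y j) ⟩
    0ℚ ∎

-- Lets the argument about positive coefficients be reused for the negative ones, which are the
-- positive ones of the negated relation.
relation-neg : (v : Vector (Vector ℚ k) n) (c : Vector ℚ n) → Relation v c → Relation v (ℚ.-_ ∘ c)
relation-neg v c rel j = begin
  sumℚ (λ e → (ℚ.- c e) ℚ.* v e j)
    ≡⟨ sum-cong-≗ (λ e → solve 2 (λ a b → (:- a) :* b := con (ℚ.- 1ℚ) :* (a :* b)) refl (c e) (v e j)) ⟩
  sumℚ (λ e → (ℚ.- 1ℚ) ℚ.* (c e ℚ.* v e j))
    ≡⟨ *-distribˡ-sum (ℚ.- 1ℚ) (λ e → c e ℚ.* v e j) ⟨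
  (ℚ.- 1ℚ) ℚ.* sumℚ (λ e → c e ℚ.* v e j)
    ≡⟨ cong ((ℚ.- 1ℚ) ℚ.*_) (rel j) ⟩
  0ℚ ∎
  where open ≡-Reasoning

nonTrivial-neg : (c : Vector ℚ n) → NonTrivial c → NonTrivial (ℚ.-_ ∘ c)
nonTrivial-neg c (e , ce≢0) = e , λ -ce≡0 → ce≢0 (ℚ.neg-injective -ce≡0)

-- Coefficient signs and separable subsets.

positives : Vector ℚ n → Subset n
positives c = Vec.tabulate (λ e → does (0ℚ ℚ.<? c e))

∈-positives⁺ : (c : Vector ℚ n) → ∀ {e} → 0ℚ ℚ.< c e → e ∈ positives c
∈-positives⁺ c {e} 0<ce = Vec.lookup⇒[]= e (positives c)
  (trans (Vec.lookup∘tabulate _ e) (dec-true (0ℚ ℚ.<? c e) 0<ce))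

∈-positives⁻ : (c : Vector ℚ n) → ∀ {e} → e ∈ positives c → 0ℚ ℚ.< c e
∈-positives⁻ c {e} e∈P = decidable-stable (0ℚ ℚ.<? c e) λ 0≮ce →
  contradiction
    (trans (sym (dec-false (0ℚ ℚ.<? c e) 0≮ce))
           (trans (sym (Vec.lookup∘tabulate _ e)) (Vec.[]=⇒lookup e∈P)))
    λ ()

-- No coefficient is both positive and negative, so the first set lies in the complement of the
-- second.
∣positives∣+∣positives-neg∣≤n : (c : Vector ℚ n) → ∣ positives c ∣ ℕ.+ ∣ positives (ℚ.-_ ∘ c) ∣ ℕ.≤ n
∣positives∣+∣positives-neg∣≤n {n} c = begin
  ∣ P ∣ ℕ.+ ∣ N ∣        ≤⟨ ℕ.+-monoˡ-≤ ∣ N ∣ (Subset.p⊆q⇒∣p∣≤∣q∣ P⊆∁N) ⟩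
  ∣ ∁ N ∣ ℕ.+ ∣ N ∣      ≡⟨ cong (ℕ._+ ∣ N ∣) (Subset.∣∁p∣≡n∸∣p∣ N) ⟩
  (n ∸ ∣ N ∣) ℕ.+ ∣ N ∣  ≡⟨ ℕ.m∸n+n≡m (Subset.∣p∣≤n N) ⟩
  n                      ∎
  where
  open ℕ.≤-Reasoning
  P N : Subset n
  P = positives c
  N = positives (ℚ.-_ ∘ c)
  P⊆∁N : P Subset.⊆ ∁ N
  P⊆∁N e∈P = Subset.x∉p⇒x∈∁p λ e∈N →
    ℚ.<-asym (ℚ.neg-antimono-< (∈-positives⁻ c e∈P)) (∈-positives⁻ (ℚ.-_ ∘ c) e∈N)

-- The signs are those of linear functionals, with `y` ranging over the whole space; affine
-- functionals are covered once the offset is stored as a coordinate.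
Separable : Vector (Vector ℚ k) n → Subset n → Set
Separable {k} v Y = ∃[ y ] (∀ e → e ∈ Y → 0ℚ ℚ.< v e ·ℚ y) × (∀ e → e ∉ Y → v e ·ℚ y ℚ.< 0ℚ)

-- For a separating `y`, each nonzero `c e` has the same sign as `v e ·ℚ y`. All terms of the sum
-- are then nonnegative and one is positive, although the relation makes the sum zero.
¬separable-positives : (v : Vector (Vector ℚ k) n) (c : Vector ℚ n) → NonTrivial c → Relation v c →
                       ¬ Separable v (positives c)
¬separable-positives v c (e₀ , ce₀≢0) rel (y , y⁺ , y⁻) =
  ℚ.<⇒≢ (sum-pos term term-nonNeg e₀ (term-pos e₀ ce₀≢0)) (sym (relation-· v c rel y))
  where
  term : Vector ℚ _
  term e = c e ℚ.* (v e ·ℚ y)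
  term-pos : ∀ e → c e ≢ 0ℚ → 0ℚ ℚ.< term e
  term-pos e ce≢0 with ℚ.<-cmp (c e) 0ℚ
  ... | tri≈ _ ce≡0 _ = contradiction ce≡0 ce≢0
  ... | tri> _ _ 0<ce = ℚ.positive⁻¹ _
    {{ℚ.pos*pos⇒pos (c e) {{ℚ.positive 0<ce}} (v e ·ℚ y) {{ℚ.positive (y⁺ e (∈-positives⁺ c 0<ce))}}}}
  -- A negative coefficient puts `e` outside `positives c`, hence on the negative side of `y`.
  ... | tri< ce<0 _ _ = ℚ.positive⁻¹ _
    {{ℚ.neg*neg⇒pos (c e) {{ℚ.negative ce<0}} (v e ·ℚ y)
      {{ℚ.negative (y⁻ e (ℚ.<-asym ce<0 ∘ ∈-positives⁻ c))}}}}
  term-nonNeg : ∀ e → 0ℚ ℚ.≤ term e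
  term-nonNeg e with c e ℚ.≟ 0ℚ
  ... | yes ce≡0 = ℚ.≤-reflexive (sym (trans (cong (ℚ._* (v e ·ℚ y)) ce≡0) (ℚ.*-zeroˡ (v e ·ℚ y))))
  ... | no  ce≢0 = ℚ.<⇒≤ (term-pos e ce≢0)

-- The positive and the negative coefficients of a relation form two inseparable sets, so each has
-- at least r + 1 elements. They are disjoint in a set of k + 1 elements, whence 2r + 2 ≤ k + 1.
separable⇒2r<k : (v : Vector (Vector ℚ k) (ℕ.suc k)) → (∀ Y → ∣ Y ∣ ℕ.≤ r → Separable v Y) → 2 * r ℕ.< k
separable⇒2r<k {k} {r} v sep =
  let c , c≢0 , rel = dependent v
      r<∣P∣ = ℕ.≰⇒> (¬separable-positives v c c≢0 rel ∘ sep (positives c))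
      r<∣N∣ = ℕ.≰⇒> (¬separable-positives v _ (nonTrivial-neg c c≢0) (relation-neg v c rel)
                      ∘ sep (positives (ℚ.-_ ∘ c)))
  in ℕ.s≤s⁻¹ (begin
    2 ℕ.+ 2 * r            ≡⟨ cong (λ s → 2 ℕ.+ (r ℕ.+ s)) (ℕ.+-identityʳ r) ⟩
    2 ℕ.+ (r ℕ.+ r)        ≡⟨ ℕ.+-suc (ℕ.suc r) r ⟨
    ℕ.suc r ℕ.+ ℕ.suc r    ≤⟨ ℕ.+-mono-≤ r<∣P∣ r<∣N∣ ⟩
    ∣ positives c ∣ ℕ.+ ∣ positives (ℚ.-_ ∘ c) ∣  ≤⟨ ∣positives∣+∣positives-neg∣≤n c ⟩
    ℕ.suc k                ∎)
  where open ℕ.≤-Reasoning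

∣Y++⊥∣≡∣Y∣ : ∀ p (Y : Subset n) → ∣ Y Vec.++ Subset.⊥ {p} ∣ ≡ ∣ Y ∣
∣Y++⊥∣≡∣Y∣ p []            = Subset.∣⊥∣≡0 p
∣Y++⊥∣≡∣Y∣ p (inside  ∷ Y) = cong ℕ.suc (∣Y++⊥∣≡∣Y∣ p Y)
∣Y++⊥∣≡∣Y∣ p (outside ∷ Y) = ∣Y++⊥∣≡∣Y∣ p Y

-- Used to cut the family down to the number of vectors that `dependent` takes. Padding with `⊥`
-- puts the surplus vectors on the negative side and leaves the size of `Y` unchanged.
separable-take : ∀ p (v : Vector (Vector ℚ k) (n ℕ.+ p)) Y →
                 Separable v (Y Vec.++ Subset.⊥ {p}) → Separable (Vector.take n v) Y
separable-take p v Y (y , y⁺ , y⁻) =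
  y , (λ e → y⁺ (e ↑ˡ p) ∘ inject) , (λ e e∉Y → y⁻ (e ↑ˡ p) (e∉Y ∘ restrict))
  where
  inject : ∀ {e} → e ∈ Y → e ↑ˡ p ∈ Y Vec.++ Subset.⊥
  inject {e} e∈Y = Vec.lookup⇒[]= _ _ (trans (Vec.lookup-++ˡ Y Subset.⊥ e) (Vec.[]=⇒lookup e∈Y))
  restrict : ∀ {e} → e ↑ˡ p ∈ Y Vec.++ Subset.⊥ → e ∈ Y
  restrict {e} e∈ = Vec.lookup⇒[]= _ _ (trans (sym (Vec.lookup-++ˡ Y Subset.⊥ e)) (Vec.[]=⇒lookup e∈))

-- Properties that hold from some index on.

Eventually : Pred ℕ ℓ → Set ℓ
Eventually P = ∃[ N ] (∀ i → N ℕ.≤ i → P i)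

eventually-× : {P Q : Pred ℕ ℓ} → Eventually P → Eventually Q → Eventually (λ i → P i × Q i)
eventually-× (M , p) (N , q) = M ℕ.⊔ N , λ i ≤i → p i (ℕ.m⊔n≤o⇒m≤o M N ≤i) , q i (ℕ.m⊔n≤o⇒n≤o M N ≤i)

eventually-map : {P Q : Pred ℕ ℓ} → (∀ {i} → P i → Q i) → Eventually P → Eventually Q
eventually-map f (N , p) = N , λ i N≤i → f (p i N≤i)

eventually-∀Fin : {P : Fin n → Pred ℕ ℓ} → (∀ e → Eventually (P e)) → Eventually (λ i → ∀ e → P e i)
eventually-∀Fin {ℕ.zero}  ev = 0 , λ _ _ ()
eventually-∀Fin {ℕ.suc n} ev = eventually-map
  (λ { (p , q) zero → p ; (p , q) (suc e) → q e })
  (eventually-× (ev zero) (eventually-∀Fin (ev ∘ suc)))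

-- There are finitely many subsets, so their thresholds have a maximum; the recursion splits on
-- whether the first element belongs to the subset.
eventually-∀Subset : {P : Subset n → Pred ℕ ℓ} → (∀ Y → Eventually (P Y)) → Eventually (λ i → ∀ Y → P Y i)
eventually-∀Subset {ℕ.zero}  ev = eventually-map (λ { p [] → p }) (ev [])
eventually-∀Subset {ℕ.suc n} ev = eventually-map
  (λ { (p , q) (inside ∷ Y) → p Y ; (p , q) (outside ∷ Y) → q Y })
  (eventually-× (eventually-∀Subset (ev ∘ (inside ∷_))) (eventually-∀Subset (ev ∘ (outside ∷_))))

-- From real hyperplanes to rational approximations.

open Real using (ℝ; seq)

<⇒eventually : ∀ {x y} → x Real.< y → Eventually (λ i → seq x i ℚ.< seq y i)
<⇒eventually {x} (ε , 0<ε , N , gap) = N , λ i N≤i →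
  ℚ.<-trans (subst (ℚ._< seq x i ℚ.+ ε) (ℚ.+-identityʳ (seq x i)) (ℚ.+-monoʳ-< (seq x i) 0<ε)) (gap i N≤i)

seq-sum : ∀ i (v : Vector ℝ k) → seq (sum v) i ≡ sumℚ (λ j → seq (v j) i)
seq-sum {ℕ.zero}  i v = refl
seq-sum {ℕ.suc k} i v = cong (seq (v zero) i ℚ.+_) (seq-sum i (v ∘ suc))

open OrientedHyperplane

-- The extra coordinate makes the affine functional a · x - b linear.
approx : ℕ → OrientedHyperplane m → Vector ℚ (ℕ.suc m)
approx i h = seq (b h) i Vector.∷ λ j → seq (a h j) i

approxPt : ℕ → ℝ^ m → Vector ℚ (ℕ.suc m)
approxPt i x = (ℚ.- 1ℚ) Vector.∷ λ j → seq (x j) i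

approx-· : ∀ i (h : OrientedHyperplane m) x → approx i h ·ℚ approxPt i x ≡ seq (a h · x) i ℚ.- seq (b h) i
approx-· i h x = begin
  seq (b h) i ℚ.* (ℚ.- 1ℚ) ℚ.+ s   ≡⟨ solve 2 (λ b s → b :* con (ℚ.- 1ℚ) :+ s := s :- b) refl (seq (b h) i) s ⟩
  s ℚ.- seq (b h) i                 ≡⟨ cong (ℚ._- seq (b h) i) (seq-sum i (λ j → a h j Real.* x j)) ⟨
  seq (a h · x) i ℚ.- seq (b h) i   ∎
  where
  open ≡-Reasoning
  s : ℚ
  s = sumℚ (λ j → seq (a h j) i ℚ.* seq (x j) i)

H⁺⇒eventually : (h : OrientedHyperplane m) → ∀ x → OrientedHyperplane.H⁺ h x →
                Eventually (λ i → 0ℚ ℚ.< approx i h ·ℚ approxPt i x)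
H⁺⇒eventually h x b<ax = eventually-map
  (λ {i} b<ax → subst (0ℚ ℚ.<_) (sym (approx-· i h x))
    (subst (ℚ._< seq (a h · x) i ℚ.- seq (b h) i) (ℚ.+-inverseʳ (seq (b h) i))
      (ℚ.+-monoˡ-< (ℚ.- seq (b h) i) b<ax)))
  (<⇒eventually {b h} {a h · x} b<ax)

H⁻⇒eventually : (h : OrientedHyperplane m) → ∀ x → OrientedHyperplane.H⁻ h x →
                Eventually (λ i → approx i h ·ℚ approxPt i x ℚ.< 0ℚ)
H⁻⇒eventually h x ax<b = eventually-map
  (λ {i} ax<b → subst (ℚ._< 0ℚ) (sym (approx-· i h x))
    (subst (seq (a h · x) i ℚ.- seq (b h) i ℚ.<_) (ℚ.+-inverseʳ (seq (b h) i))
      (ℚ.+-monoˡ-< (ℚ.- seq (b h) i) ax<b)))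
  (<⇒eventually {a h · x} {b h} ax<b)

separates⇒eventually-separable : (H : Fin n → OrientedHyperplane m) (Y : Subset n) → ∀ x →
  (∀ e → e ∈ Y → OrientedHyperplane.H⁺ (H e) x) → (∀ e → e ∉ Y → OrientedHyperplane.H⁻ (H e) x) →
  Eventually (λ i → Separable (approx i ∘ H) Y)
separates⇒eventually-separable H Y x x⁺ x⁻ = eventually-map
  (λ {i} sides → approxPt i x , proj₁ ∘ sides , proj₂ ∘ sides)
  (eventually-∀Fin side)
  where
  side : ∀ e → Eventually (λ i → (e ∈ Y → 0ℚ ℚ.< approx i (H e) ·ℚ approxPt i x)
                               × (e ∉ Y → approx i (H e) ·ℚ approxPt i x ℚ.< 0ℚ))
  -- Membership is decided before an index is chosen: only one of the two inequalities has a
  -- threshold, and the other implication is vacuous.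
  side e with e Subset.∈? Y
  ... | yes e∈Y = eventually-map (λ pos → (λ _ → pos) , λ e∉Y → contradiction e∈Y e∉Y)
                    (H⁺⇒eventually (H e) x (x⁺ e e∈Y))
  ... | no  e∉Y = eventually-map (λ neg → (λ e∈Y → contradiction e∈Y e∉Y) , λ _ → neg)
                    (H⁻⇒eventually (H e) x (x⁻ e e∉Y))

-- The index must serve all `Y` at once: the subsets to be tested come from a relation between the
-- approximations, so they are known only after the index is fixed.
eventually-separable : (R : Realization ℓ (U r n) m) →
  Eventually (λ i → ∀ Y → ∣ Y ∣ ℕ.≤ r → Separable (approx i ∘ Realization.H R) Y)
eventually-separable {r = r} R = eventually-∀Subset each
  where
  open Realization R
  each : ∀ Y → Eventually (λ i → ∣ Y ∣ ℕ.≤ r → Separable (approx i ∘ H) Y)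
  each Y with ∣ Y ∣ ℕ.≤? r
  -- The realization supplies a point, and with it a threshold, only for members of the family; for
  -- other subsets the claim is vacuous and 0 will do.
  ... | no  ∣Y∣≰r = 0 , λ _ _ ∣Y∣≤r → contradiction ∣Y∣≤r ∣Y∣≰r
  ... | yes ∣Y∣≤r =
    let x , _ , x⁺ , x⁻ = Equivalence.to (realizes Y) ∣Y∣≤r
    in eventually-map (λ sep _ → sep) (separates⇒eventually-separable H Y x x⁺ x⁻)

theorem44 : ∀ (ℓ : Level) (r n : ℕ) → (2 * r) ⊓ (n ∸ 1) ≤dim𝔼[ ℓ ] U r n
theorem44 ℓ r n m R with 2 ℕ.+ m ℕ.≤? n
-- Here n ≤ m + 1, so the second argument of the minimum is already at most m.
... | no 2+m≰n = ℕ.≤-trans (ℕ.m⊓n≤n (2 * r) (n ∸ 1)) (ℕ.∸-monoˡ-≤ 1 (ℕ.s≤s⁻¹ (ℕ.≰⇒> 2+m≰n)))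
... | yes 2+m≤n with ℕ.m≤n⇒∃[o]m+o≡n 2+m≤n
-- The first m + 2 approximations live in dimension m + 1, because of the coordinate for the offset;
-- this yields 2r < m + 1.
... | p , refl = ℕ.≤-trans (ℕ.m⊓n≤m (2 * r) (n ∸ 1)) (ℕ.s≤s⁻¹ (separable⇒2r<k (Vector.take (2 ℕ.+ m) v) sep))
  where
  i : ℕ
  -- Any index past the threshold would do; the threshold itself is taken.
  i = proj₁ (eventually-separable R)
  v : Vector (Vector ℚ (ℕ.suc m)) (2 ℕ.+ m ℕ.+ p)
  v = approx i ∘ Realization.H R
  sep : ∀ Y → ∣ Y ∣ ℕ.≤ r → Separable (Vector.take (2 ℕ.+ m) v) Y
  sep Y ∣Y∣≤r = separable-take p v Y
    (proj₂ (eventually-separable R) i ℕ.≤-refl (Y Vec.++ Subset.⊥)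
      (subst (ℕ._≤ r) (sym (∣Y++⊥∣≡∣Y∣ p Y)) ∣Y∣≤r))
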